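{- Let $n\ge 2$ and let $A_n$ be the $n\times n$ Hessenberg-Toeplitz matrix with coefficients $a_{ -1},a_0,\dots,a_{n-1}$, where $a_{ -1}\neq 0$. Let $x=(x_{n-1},x_{n-2},\ldots,x_0)^{\top}$ be an eigenvector of $A_n$ associated to an eigenvalue $\lambda$. Then for all $i=1,\ldots,n-1$, $$x_i=\left(\frac{ -1}{a_{ -1}}\right)^{i} d_i(\lambda)\,x_0,$$ where $d_i(\lambda)$ is the characteristic polynomial of $A_i$.
   Context: For scalars (complex numbers) $a_{ -1},a_0,a_1,\dots$, the (upper) Hessenberg-Toeplitz matrix $A_m$ is the $m\times m$ matrix whose $(p,q)$ entry is $a_{q-p}$ if $q-p\ge -1$ and $0$ otherwise, that is $$A_{m} = \begin{pmatrix} a_{0} & a_{1} & a_{2} & \cdots & a_{m-1} \\ a_{ -1} & a_{0} & a_{1} & \cdots & a_{m-2} \\ 0 & a_{ -1} & a_{0} & \cdots & a_{m-3} \\ \vdots & \vdots & \vdots & \ddots & \vdots \\ 0 & 0 & 0 & \cdots & a_{0} \end{pmatrix}.$$ The matrices $A_i$, $i\le n$, use the same coefficients. The characteristic polynomial of an $m\times m$ matrix $A_m$ is $\det(A_m-\lambda I)$. Note that the entries of $x$ are indexed in decreasing order, so $x_0$ is the last entry. -}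

module Defs where

open import Algebra.Apartness.Bundles using (HeytingField; HeytingCommutativeRing)
open import Algebra.Bundles using (CommutativeRing)
import Algebra.Apartness.Properties.HeytingCommutativeRing as HeytingProperties
import Algebra.Properties.Semiring.Exp as Exp
import Algebra.Properties.Semiring.Sum as Sum
open import Data.Bool.Base using (if_then_else_)
open import Data.Fin.Base using (Fin; zero; suc; toℕ)
open import Data.Fin.Properties using (_≟_)
open import Data.Integer.Base as ℤ using (ℤ; +_; -1ℤ)
open import Data.Integer.Properties using (_≤?_)
open import Data.Nat.Base using (ℕ; zero; suc)
open import Data.Product.Base using (∃; _×_; proj₁; proj₂)
open import Data.Vec.Functional using (Vector; map; removeAt)
open import Level using (_⊔_)
open import Relation.Nullary.Decidable.Core using (does)

-- The scalars form an arbitrary Heyting field; "nonzero" is apartness from 0#.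
-- The complex numbers are an instance.  Over a classical field, _#_ can be
-- taken to be the negation of _≈_.

module LinearAlgebra {c ℓ₁ ℓ₂} (K : HeytingField c ℓ₁ ℓ₂) where

  open HeytingField K hiding (zero)
  open HeytingCommutativeRing heytingCommutativeRing using (commutativeRing)
  open CommutativeRing commutativeRing using (semiring)
  open HeytingProperties heytingCommutativeRing using (x-0≈x)
  open Exp semiring public using (_^_)
  open Sum semiring public using (sum)

  -- #⇒invertible inverts x - 0#, hence x: see x*x⁻¹≈1.

  inverse : ∀ x → x # 0# → Carrier
  inverse x x#0 = proj₁ (#⇒invertible x#0)

  x*x⁻¹≈1 : ∀ x (x#0 : x # 0#) → x * inverse x x#0 ≈ 1#
  x*x⁻¹≈1 x x#0 =
    trans (*-congʳ (sym (x-0≈x x))) (proj₂ (proj₂ (#⇒invertible x#0)))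

  infixl 7 _/_[_]
  _/_[_] : ∀ (y x : Carrier) → x # 0# → Carrier
  y / x [ x#0 ] = y * inverse x x#0

  Matrix : ℕ → Set c
  Matrix m = Vector (Vector Carrier m) m

  infixl 6 _-ᴹ_
  _-ᴹ_ : ∀ {m} → Matrix m → Matrix m → Matrix m
  (A -ᴹ B) p q = A p q - B p q

  infixr 7 _*ₗ_
  _*ₗ_ : ∀ {m} → Carrier → Matrix m → Matrix m
  (μ *ₗ A) p q = μ * A p q

  I : ∀ {m} → Matrix m
  I p q = if does (p ≟ q) then 1# else 0#

  minor : ∀ {m} → Matrix (suc m) → Fin (suc m) → Fin (suc m) → Matrix m
  minor A p q = map (λ row → removeAt row q) (removeAt A p)

  -- Cofactor (Laplace) expansion along the first column.

  det : ∀ {m} → Matrix m → Carrier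
  det {zero}  A = 1#
  det {suc m} A = sum λ p → (- 1#) ^ toℕ p * A p zero * det (minor A p zero)

  -- The characteristic polynomial, as the function of its variable; the
  -- normalisation det (A - μ I) makes the leading coefficient (-1)ᵐ.

  charPoly : ∀ {m} → Matrix m → Carrier → Carrier
  charPoly A μ = det (A -ᴹ μ *ₗ I)

  IsEigenvector : ∀ {m} → Matrix m → Carrier → Vector Carrier m → Set (ℓ₁ ⊔ ℓ₂)
  IsEigenvector A μ v =
    (∃ λ p → v p # 0#) × (∀ p → sum (λ q → A p q * v q) ≈ μ * v p)

  -- Values a k with k < -1 are never used, and neither are those with k ≥ m.

  hessenbergToeplitz : (ℤ → Carrier) → ∀ m → Matrix m
  hessenbergToeplitz a m p q =
    if does (-1ℤ ≤? q-p) then a q-p else 0#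
    where
    q-p : ℤ
    q-p = + toℕ q ℤ.- + toℕ p

{-# OPTIONS --safe #-}

-- Put e = -1/a₋₁, dₙ = det (Aₙ - λI), and let D(r, n) be the determinant of
-- Aₙ₊₁ - λI with its first row replaced by r.  Let v = (xₙ, …, x₀) satisfy the
-- eigenvalue equations of all rows but the first; the tail of v then does so
-- for the next smaller size.  Expansion along the first column gives
--   D(r, n+1) = r₀ dₙ₊₁ - a₋₁ D(tail r, n).
-- Splitting off the first term of r · v gives the same recursion up to the
-- factors eⁿ x₀, hence r · v = eⁿ D(r, n) x₀, provided xₙ = eⁿ dₙ x₀.  The
-- latter is the case of one size less, because the equation of the second row
-- reads xₙ₊₁ = e (r · tail v) with r the first row of Aₙ₊₁ - λI.

module Submission where

open import Defs
open import Algebra.Apartness.Bundles using (HeytingField; HeytingCommutativeRing)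
open import Algebra.Bundles using (CommutativeRing)
import Algebra.Properties.CommutativeSemigroup as CommutativeSemigroupProperties
import Algebra.Properties.Ring as RingProperties
import Algebra.Properties.Semiring.Sum as SumProperties
open import Data.Fin.Base using (Fin; zero; suc; toℕ; fromℕ; fromℕ<; opposite; punchIn)
open import Data.Fin.Properties
  using (toℕ-fromℕ; toℕ-fromℕ<; opposite-suc; opposite-involutive)
open import Data.Integer.Base using (ℤ; -1ℤ)
open import Data.Integer.Properties using (_≤?_; m-n≡m⊖n; [1+m]⊖[1+n]≡m⊖n)
open import Data.Bool.Base using (if_then_else_)
open import Data.Nat.Base using (ℕ; zero; suc; _≤_; _<_; z<s)
open import Data.Nat.Properties using (<-trans)
open import Data.Product.Base using (_,_)
open import Data.Vec.Functional using (Vector; _∷_; head; tail; last; reverse)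
open import Relation.Binary.PropositionalEquality as ≡ using (_≡_)
open import Relation.Nullary.Decidable.Core using (does)

module HessenbergProperties {c ℓ₁ ℓ₂} (K : HeytingField c ℓ₁ ℓ₂) where

  open HeytingField K using (heytingCommutativeRing; _#_)
  open HeytingCommutativeRing heytingCommutativeRing using (commutativeRing)
  open CommutativeRing commutativeRing hiding (zero)
  open RingProperties ring using (-1*x≈-x; -‿distribˡ-*; -‿distribʳ-*; -0#≈0#)
  open import Algebra.Properties.Group +-group using (inverseʳ-unique; ⁻¹-involutive)
  open SumProperties semiring
    using (sum-cong-≋; sum-replicate-zero; ∑-distrib-+; *-distribˡ-sum)
  open CommutativeSemigroupProperties *-commutativeSemigroup using (x∙yz≈y∙xz)
  open LinearAlgebra K
  open import Relation.Binary.Reasoning.Setoid setoid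

  infix 8 _·_
  _·_ : ∀ {m} → Vector Carrier m → Vector Carrier m → Carrier
  r · v = sum λ q → r q * v q

  sum≈0 : ∀ {m} (t : Vector Carrier m) → (∀ p → t p ≈ 0#) → sum t ≈ 0#
  sum≈0 {m} t t≈0 = trans (sum-cong-≋ {m} t≈0) (sum-replicate-zero m)

  det-cong : ∀ {m} {A B : Matrix m} → (∀ p q → A p q ≈ B p q) → det A ≈ det B
  det-cong {zero}  A≈B = refl
  det-cong {suc m} A≈B = sum-cong-≋ {suc m} λ p →
    *-cong (*-congˡ {x = (- 1#) ^ toℕ p} (A≈B p zero)) (det-cong λ i j → A≈B (punchIn p i) (suc j))

  -- Every cofactor term from the third row on has a zero factor; the sign of the second term is
  -- absorbed into its entry.
  det-expand₂ : ∀ {m} (A : Matrix (suc (suc m))) → (∀ p → A (suc (suc p)) zero ≈ 0#) →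
    det A ≈ A zero zero * det (minor A zero zero)
          + - A (suc zero) zero * det (minor A (suc zero) zero)
  det-expand₂ A below≈0 = +-cong (*-congʳ (*-identityˡ _)) (begin
    (- 1# * 1#) * A (suc zero) zero * det (minor A (suc zero) zero) + rest
      ≈⟨ +-cong (*-congʳ (trans (*-congʳ (*-identityʳ _)) (-1*x≈-x _))) rest≈0 ⟩
    - A (suc zero) zero * det (minor A (suc zero) zero) + 0#
      ≈⟨ +-identityʳ _ ⟩
    - A (suc zero) zero * det (minor A (suc zero) zero) ∎)
    where
    rest = sum λ p → (- 1#) ^ suc (suc (toℕ p)) * A (suc (suc p)) zero
                     * det (minor A (suc (suc p)) zero)
    rest≈0 = sum≈0 _ λ p →
      trans (*-congʳ (trans (*-congˡ (below≈0 p)) (zeroʳ _))) (zeroˡ _)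

  ·-congʳ : ∀ {m} (r s v : Vector Carrier m) → (∀ q → r q ≈ s q) → r · v ≈ s · v
  ·-congʳ {m} r s v r≈s = sum-cong-≋ {m} λ q → *-congʳ {v q} (r≈s q)

  ·-identity : ∀ {m} (p : Fin m) (v : Vector Carrier m) → I p · v ≈ v p
  ·-identity zero v =
    trans (+-cong (*-identityˡ _) (sum≈0 (λ q → 0# * tail v q) λ q → zeroˡ _)) (+-identityʳ _)
  ·-identity (suc p) v =
    trans (+-cong (zeroˡ _) (·-identity p (tail v))) (+-identityˡ _)

  *-distribˡ-· : ∀ {m} μ (r v : Vector Carrier m) → (λ q → μ * r q) · v ≈ μ * r · v
  *-distribˡ-· {m} μ r v = trans
    (sum-cong-≋ {m} λ q → *-assoc μ (r q) (v q))
    (sym (*-distribˡ-sum μ λ q → r q * v q))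

  eigen⇒kernel : ∀ {m} (A : Matrix m) μ v → IsEigenvector A μ v →
    ∀ p → (A -ᴹ μ *ₗ I) p · v ≈ 0#
  eigen⇒kernel {m} A μ v (_ , Av≈μv) p = begin
    (A -ᴹ μ *ₗ I) p · v
      ≈⟨ sum-cong-≋ {m} (λ q → trans
           (distribʳ (v q) (A p q) (- (μ * I p q)))
           (+-congˡ {A p q * v q} (*-congʳ {v q} (-‿distribˡ-* μ (I p q))))) ⟩
    (sum λ q → A p q * v q + (- μ * I p q) * v q)
      ≈⟨ ∑-distrib-+ (λ q → A p q * v q) (λ q → (- μ * I p q) * v q) ⟩
    A p · v + (λ q → - μ * I p q) · v
      ≈⟨ +-cong (Av≈μv p) (trans (*-distribˡ-· (- μ) (I p) v) (*-congˡ (·-identity p v))) ⟩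
    μ * v p + - μ * v p
      ≈⟨ +-congˡ (-‿distribˡ-* μ (v p)) ⟨
    μ * v p + - (μ * v p)
      ≈⟨ -‿inverseʳ _ ⟩
    0# ∎

  -- Abstracts the matrices Aₘ - μI: `b` is a₋₁, and `e` is -1/a₋₁, given by the equation it
  -- satisfies.
  module HessenbergToeplitzFamily
    (B : ∀ m → Matrix m) (b e : Carrier)
    (e*-b≈1 : e * - b ≈ 1#)
    (B-shift : ∀ m p q → B (suc m) (suc p) (suc q) ≈ B m p q)
    (B-subdiagonal : ∀ m → B (suc (suc m)) (suc zero) zero ≈ b)
    (B-below : ∀ m (p : Fin m) → B (suc (suc m)) (suc (suc p)) zero ≈ 0#)
    where

    -- The matrices behind D(r, n). Deleting the second row and first column shortens the top row,
    -- so a free top row makes the class closed under expansion.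
    withTopRow : ∀ {m} → Vector Carrier (suc m) → Matrix (suc m)
    withTopRow {m} r = r ∷ tail (B (suc m))

    det-withTopRow : ∀ {m} (r : Vector Carrier (suc (suc m))) →
      det (withTopRow r) ≈ head r * det (B (suc m)) + - b * det (withTopRow (tail r))
    det-withTopRow {m} r = trans (det-expand₂ (withTopRow r) (B-below m)) (+-cong
      (*-congˡ (det-cong (B-shift (suc m))))
      (*-cong (-‿cong (B-subdiagonal m)) minor≈))
      where
      minor≈ : det (minor (withTopRow r) (suc zero) zero) ≈ det (withTopRow (tail r))
      minor≈ = det-cong {A = minor (withTopRow r) (suc zero) zero} {withTopRow (tail r)} λ where
        zero    q → refl
        (suc p) q → B-shift (suc m) (suc p) q

    -- Leaving out the first row makes the condition pass to `tail v`: the first row of the smaller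
    -- matrix comes from the second row here, whose equation also involves `head v`.
    RowEquations : ∀ {n} → Vector Carrier (suc n) → Set ℓ₁
    RowEquations {n} v = ∀ (p : Fin n) → B (suc n) (suc p) · v ≈ 0#

    -- Rows from the third on start with zero, so `head v` drops out; the shift identifies what
    -- remains.
    rowEquations-tail : ∀ {n} (v : Vector Carrier (suc (suc n))) →
      RowEquations v → RowEquations (tail v)
    rowEquations-tail {n} v Bv≈0 p = begin
      B (suc n) (suc p) · tail v
        ≈⟨ ·-congʳ (tail (B (suc (suc n)) (suc (suc p)))) (B (suc n) (suc p)) (tail v)
             (B-shift (suc n) (suc p)) ⟨
      tail (B (suc (suc n)) (suc (suc p))) · tail v
        ≈⟨ +-identityˡ _ ⟨
      0# + tail (B (suc (suc n)) (suc (suc p))) · tail v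
        ≈⟨ +-congʳ (trans (*-congʳ (B-below n p)) (zeroˡ _)) ⟨
      B (suc (suc n)) (suc (suc p)) · v
        ≈⟨ Bv≈0 (suc p) ⟩
      0# ∎

    head-recurrence : ∀ {n} (v : Vector Carrier (suc (suc n))) → RowEquations v →
      head v ≈ e * head (B (suc n)) · tail v
    head-recurrence {n} v Bv≈0 = begin
      head v                        ≈⟨ *-identityˡ _ ⟨
      1# * head v                   ≈⟨ *-congʳ e*-b≈1 ⟨
      (e * - b) * head v            ≈⟨ *-assoc _ _ _ ⟩
      e * (- b * head v)            ≈⟨ *-congˡ (-‿distribˡ-* b (head v)) ⟨
      e * - (b * head v)            ≈⟨ *-congˡ (inverseʳ-unique _ _ row₁) ⟨
      e * head (B (suc n)) · tail v ∎
      where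
      row₁ : b * head v + head (B (suc n)) · tail v ≈ 0#
      row₁ = trans
        (+-cong (*-congʳ (sym (B-subdiagonal n)))
                (·-congʳ (head (B (suc n))) (tail (B (suc (suc n)) (suc zero))) (tail v)
                  λ q → sym (B-shift (suc n) zero q)))
        (Bv≈0 zero)

    -- The hypothesis is `·≈det` one size down, so this serves both inside that induction and in
    -- `head≈det`.
    head-from-· : ∀ {n} (v : Vector Carrier (suc (suc n))) → RowEquations v →
      head (B (suc n)) · tail v ≈ e ^ n * det (withTopRow (head (B (suc n)))) * last v →
      head v ≈ e ^ suc n * det (B (suc n)) * last v
    head-from-· {n} v Bv≈0 r·v = begin
      head v                                        ≈⟨ head-recurrence v Bv≈0 ⟩
      e * head (B (suc n)) · tail v                 ≈⟨ *-congˡ r·v ⟩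
      e * (e ^ n * det (withTopRow (head (B (suc n)))) * last v)
        ≈⟨ *-assoc _ _ _ ⟨
      e * (e ^ n * det (withTopRow (head (B (suc n))))) * last v
        ≈⟨ *-congʳ (*-assoc _ _ _) ⟨
      e ^ suc n * det (withTopRow (head (B (suc n)))) * last v
        ≈⟨ *-congʳ (*-congˡ topRow) ⟩
      e ^ suc n * det (B (suc n)) * last v          ∎
      where
      topRow : det (withTopRow (head (B (suc n)))) ≈ det (B (suc n))
      -- Both sides agree only entry by entry: `_∷_` does not reduce at a variable index.
      topRow = det-cong {A = withTopRow (head (B (suc n)))} {B (suc n)} λ where
        zero    q → refl
        (suc p) q → refl

    -- The row `r` is arbitrary because the induction uses two rows: `tail r`, and the first row of
    -- the smaller matrix, which yields `head v`.
    ·≈det : ∀ {n} (r v : Vector Carrier (suc n)) → RowEquations v →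
      r · v ≈ e ^ n * det (withTopRow r) * last v
    -- The one-by-one determinant unfolds to `1# * head r * 1# + 0#`, and `last v` is `head v`.
    ·≈det {zero} r v _ = begin
      head r * head v + 0#                       ≈⟨ +-identityʳ _ ⟩
      head r * head v                            ≈⟨ *-congʳ (*-identityˡ _) ⟨
      1# * head r * head v                       ≈⟨ *-congʳ (*-identityʳ _) ⟨
      1# * head r * 1# * head v                  ≈⟨ *-congʳ (+-identityʳ _) ⟨
      (1# * head r * 1# + 0#) * head v           ≈⟨ *-congʳ (*-identityˡ _) ⟨
      1# * (1# * head r * 1# + 0#) * head v      ∎
    ·≈det {suc n} r v Bv≈0 = begin
      head r * head v + tail r · tail v
        ≈⟨ +-cong (*-congˡ (head-from-· v Bv≈0 (ih (head (B (suc n)))))) (ih (tail r)) ⟩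
      head r * (e ^ suc n * d * last v) + e ^ n * D * last v
        ≈⟨ +-congʳ (*-assoc _ _ _) ⟨
      head r * (e ^ suc n * d) * last v + e ^ n * D * last v
        ≈⟨ distribʳ _ _ _ ⟨
      (head r * (e ^ suc n * d) + e ^ n * D) * last v
        -- Inserting `1# ≈ e * - b` supplies the missing factor `e` and the `- b` of the determinant
        -- recursion.
        ≈⟨ *-congʳ (+-cong (x∙yz≈y∙xz _ _ _) e^n*D) ⟩
      (e ^ suc n * (head r * d) + e ^ suc n * (- b * D)) * last v
        ≈⟨ *-congʳ (distribˡ _ _ _) ⟨
      e ^ suc n * (head r * d + - b * D) * last v
        ≈⟨ *-congʳ (*-congˡ (det-withTopRow r)) ⟨
      e ^ suc n * det (withTopRow r) * last v ∎
      where
      d = det (B (suc n))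
      D = det (withTopRow (tail r))
      ih = λ r′ → ·≈det r′ (tail v) (rowEquations-tail v Bv≈0)
      e^n*D : e ^ n * D ≈ e ^ suc n * (- b * D)
      e^n*D = begin
        e ^ n * D                   ≈⟨ *-identityˡ _ ⟨
        1# * (e ^ n * D)            ≈⟨ *-congʳ e*-b≈1 ⟨
        (e * - b) * (e ^ n * D)     ≈⟨ *-assoc _ _ _ ⟩
        e * (- b * (e ^ n * D))     ≈⟨ *-congˡ (x∙yz≈y∙xz _ _ _) ⟩
        e * (e ^ n * (- b * D))     ≈⟨ *-assoc _ _ _ ⟨
        e ^ suc n * (- b * D)       ∎

    head≈det : ∀ {n} (v : Vector Carrier (suc n)) → RowEquations v →
      head v ≈ e ^ n * det (B n) * last v
    head≈det {zero}  v _    = sym (trans (*-congʳ (*-identityˡ _)) (*-identityˡ _))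
    head≈det {suc n} v Bv≈0 =
      head-from-· v Bv≈0 (·≈det _ (tail v) (rowEquations-tail v Bv≈0))

    -- Discarding the entries before position `j` makes its entry the head and keeps `last v`;
    -- `opposite j` counts the entries after it.
    entry≈det : ∀ {n} (v : Vector Carrier (suc n)) → RowEquations v → ∀ {i} j →
      toℕ (opposite j) ≡ i → v j ≈ e ^ i * det (B i) * last v
    entry≈det {n} v Bv≈0 zero eq rewrite ≡.sym eq | toℕ-fromℕ n = head≈det v Bv≈0
    entry≈det {suc n} v Bv≈0 (suc j) eq =
      entry≈det (tail v) (rowEquations-tail v Bv≈0) j
        (≡.trans (≡.sym (opposite-suc j)) eq)

  hessenbergToeplitz-shift : ∀ a m p q →
    hessenbergToeplitz a (suc m) (suc p) (suc q) ≡ hessenbergToeplitz a m p q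
  hessenbergToeplitz-shift a m p q =
    ≡.cong (λ k → if does (-1ℤ ≤? k) then a k else 0#)
      -- The difference of successors computes to `_⊖_`; the other difference does not, hence the
      -- second equation.
      (≡.trans ([1+m]⊖[1+n]≡m⊖n (toℕ q) (toℕ p)) (≡.sym (m-n≡m⊖n (toℕ q) (toℕ p))))

  -- For entries off the diagonal, where `μ *ₗ I` contributes `μ * 0#`.
  x-y0≈x : ∀ x y → x - y * 0# ≈ x
  x-y0≈x x y = trans (+-congˡ (trans (-‿cong (zeroʳ y)) -0#≈0#)) (+-identityʳ x)

  -1/x*-x≈1 : ∀ x (x#0 : x # 0#) → ((- 1#) / x [ x#0 ]) * - x ≈ 1#
  -1/x*-x≈1 x x#0 = begin
    (- 1# * inverse x x#0) * - x   ≈⟨ *-congʳ (-1*x≈-x _) ⟩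
    - inverse x x#0 * - x          ≈⟨ -‿distribˡ-* _ _ ⟨
    - (inverse x x#0 * - x)        ≈⟨ -‿cong (-‿distribʳ-* _ _) ⟨
    - - (inverse x x#0 * x)        ≈⟨ ⁻¹-involutive _ ⟩
    inverse x x#0 * x              ≈⟨ *-comm _ _ ⟩
    x * inverse x x#0              ≈⟨ x*x⁻¹≈1 x x#0 ⟩
    1#                             ∎

theorem4 : ∀ {c ℓ₁ ℓ₂} (K : HeytingField c ℓ₁ ℓ₂) →
    let open HeytingField K
        open LinearAlgebra K
    in
    (n : ℕ) (2≤n : 2 ≤ n)
    (a : ℤ → Carrier) (a₋₁#0 : a -1ℤ # 0#)
    (μ : Carrier)
    -- x lists x₀, …, xₙ₋₁ by subscript; the column vector is its reverse.
    (x : Vector Carrier n) →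
    IsEigenvector (hessenbergToeplitz a n) μ (reverse x) →
    (i : ℕ) → 1 ≤ i → (i<n : i < n) →
    x (fromℕ< i<n)
      ≈ ((- 1#) / a -1ℤ [ a₋₁#0 ]) ^ i
        * charPoly (hessenbergToeplitz a i) μ
        * x (fromℕ< (<-trans z<s 2≤n))
theorem4 K (suc n) 2≤n a a₋₁#0 μ x eigen i _ i<n =
  -- As `reverse` composes with `opposite`, both indices of `x` arrive as double opposites;
  -- `opposite zero` is the last index.
  ≡.subst₂ (λ j k → x j ≈ ((- 1#) / a -1ℤ [ a₋₁#0 ]) ^ i
                      * charPoly (hessenbergToeplitz a i) μ * x k)
    (opposite-involutive (fromℕ< i<n)) (opposite-involutive zero)
    (entry≈det (reverse x) (λ p → eigen⇒kernel (hessenbergToeplitz a (suc n)) μ _ eigen (suc p))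
      (opposite (fromℕ< i<n))
      (≡.trans (≡.cong toℕ (opposite-involutive (fromℕ< i<n))) (toℕ-fromℕ< i<n)))
  where
  open HeytingField K hiding (zero)
  open LinearAlgebra K
  open HessenbergProperties K
  open HessenbergToeplitzFamily
    (λ m → hessenbergToeplitz a m -ᴹ μ *ₗ I)
    (a -1ℤ) ((- 1#) / a -1ℤ [ a₋₁#0 ]) (-1/x*-x≈1 _ a₋₁#0)
    -- The identity matrix shifts by computation, which leaves the Toeplitz part.
    (λ m p q → +-congʳ (reflexive (hessenbergToeplitz-shift a m p q)))
    (λ m → x-y0≈x _ μ)
    (λ m p → x-y0≈x _ μ)
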